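{- For each $k\in\mathbb{N}$ there exists an instance of the Strip Packing Problem (together with an initial ordering) such that the bottom-left $k$-local search algorithm takes a number of improvement steps that is exponential with respect to the instance size before reaching a local optimum.
   Context: Strip Packing Problem: given a strip width $W>0$ and rectangles $r_1,\dots,r_n$ with widths $w_i\le W$ and heights $h_i$, a packing assigns to each $r_i$ a lower-left corner $(x_i,y_i)$; it is feasible if $x_i\ge 0$, $x_i+w_i\le W$, $y_i\ge 0$ and the open rectangles $(x_i,x_i+w_i)\times(y_i,y_i+h_i)$ are pairwise disjoint; no rotations. The height of a packing is $\max_i(y_i+h_i)$. Bottom-left algorithm: given an ordering, place the first rectangle at $(0,0)$ and then each subsequent rectangle at a feasible position $(x,y)$ (feasible together with those already placed) with $(y,x)$ lexicographically minimal. Bottom-left $k$-local search algorithm: start with an initial ordering and its bottom-left packing. In each iteration (improvement step), choose a new ordering obtained from the current one by permuting at most $k$ rectangles in the ordering such that the bottom-left packing of the new ordering has strictly smaller height, and replace the current ordering by it. Stop when no such improvement exists (a local optimum).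
   Formalization: The claim is proved for each k ≥ 2; for k = 0 and k = 1 it is false, since permuting at most one rectangle leaves the ordering unchanged and no improvement step exists. -}

module Defs where

open import Data.Fin.Base as Fin using (Fin)
import Data.Fin.Properties as Fin
open import Data.Fin.Permutation using (Permutation′; _⟨$⟩ʳ_; _⟨$⟩ˡ_)
open import Data.Integer.Base using (∣_∣)
open import Data.Nat.Base as ℕ using (ℕ; suc)
open import Data.Nat.Logarithm using (⌊log₂_⌋)
open import Data.Product.Base using (_×_; _,_; ∃-syntax)
open import Data.Product.Relation.Binary.Lex.Strict using (×-Lex)
open import Data.Rational.Base using (ℚ; 0ℚ; _+_; _⊔_; _≤_; _<_; ↥_; ↧ₙ_)
open import Data.Vec.Base using (allFin; count)
open import Data.Vec.Functional using (foldr)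
open import Relation.Binary.Construct.Closure.ReflexiveTransitive using (Star; fold)
open import Relation.Binary.PropositionalEquality.Core using (_≡_)
open import Relation.Nullary.Decidable.Core using (¬?)
open import Relation.Nullary.Negation.Core using (¬_)
open import Relation.Unary using (Pred; _⊥_)
open import Level using (0ℓ)

record Instance : Set where
  field
    W   : ℚ
    n   : ℕ
    w   : Fin n → ℚ
    h   : Fin n → ℚ
    0<W : 0ℚ < W
    0<w : ∀ i → 0ℚ < w i
    w≤W : ∀ i → w i ≤ W
    0<h : ∀ i → 0ℚ < h i

-- Number of binary digits of a natural number (one digit for 0).
bits : ℕ → ℕ
bits a = 1 ℕ.+ ⌊log₂ a ⌋

bitsℚ : ℚ → ℕ
bitsℚ q = bits ∣ ↥ q ∣ ℕ.+ bits (↧ₙ q)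

encodingLength : Instance → ℕ
encodingLength I = bitsℚ W ℕ.+ foldr ℕ._+_ 0 (λ i → bitsℚ (w i) ℕ.+ bitsℚ (h i))
  where open Instance I

-- A point (x , y), also used for the lower-left corner of a rectangle.
Point : Set
Point = ℚ × ℚ

module _ (I : Instance) where
  open Instance I

  Packing : Set
  Packing = Fin n → Point

  -- σ ⟨$⟩ʳ t is the rectangle in place t of the ordering σ.
  Ordering : Set
  Ordering = Permutation′ n

  -- The open rectangle occupied by rectangle i when its corner is (x , y).
  -- Since ℚ is dense, two such sets are disjoint over ℚ exactly when the
  -- corresponding open rectangles of the real plane are.
  Interior : Fin n → Point → Pred Point 0ℓ
  Interior i (x , y) (a , b) = (x < a × a < x + w i) × (y < b × b < y + h i)

  -- Rectangle i can be put at (x , y) given that the rectangles satisfying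
  -- Placed already lie where p says.
  Feasible : Pred (Fin n) 0ℓ → Packing → Fin n → Pred Point 0ℓ
  Feasible Placed p i (x , y) =
      0ℚ ≤ x
    × x + w i ≤ W
    × 0ℚ ≤ y
    × (∀ j → Placed j → Interior i (x , y) ⊥ Interior j (p j))

  Before : Ordering → Fin n → Pred (Fin n) 0ℓ
  Before σ t j = (σ ⟨$⟩ˡ j) Fin.< t

  -- (x , y) ≼ (x′ , y′) compares (y , x) with (y′ , x′) lexicographically.
  _≼_ : Point → Point → Set
  (x , y) ≼ (x′ , y′) = ×-Lex _≡_ _<_ _≤_ (y , x) (y′ , x′)

  -- p is the packing the bottom-left algorithm computes for σ.  For t = 0
  -- nothing is placed yet, so the least feasible position is (0 , 0).
  IsBottomLeft : Ordering → Packing → Set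
  IsBottomLeft σ p = ∀ t → let i = σ ⟨$⟩ʳ t in
      Feasible (Before σ t) p i (p i)
    × (∀ q → Feasible (Before σ t) p i q → p i ≼ q)

  -- The base value 0ℚ does not affect the maximum: in a feasible packing
  -- every top edge is positive.
  height : Packing → ℚ
  height p = foldr _⊔_ 0ℚ (λ i → top i (p i))
    where
    top : Fin n → Point → ℚ
    top i (_ , y) = y + h i

  moved : Ordering → Ordering → ℕ
  moved σ τ = count (λ t → ¬? ((σ ⟨$⟩ʳ t) Fin.≟ (τ ⟨$⟩ʳ t))) (allFin n)

  record State : Set where
    field
      ordering     : Ordering
      packing      : Packing
      isBottomLeft : IsBottomLeft ordering packing

  open State

  -- An improvement step permuting at most k rectangles in the ordering.
  Improvement : ℕ → State → State → Set
  Improvement k S T =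
      moved (ordering S) (ordering T) ℕ.≤ k
    × height (packing T) < height (packing S)

  LocalOptimum : ℕ → State → Set
  LocalOptimum k S = ¬ (∃[ T ] Improvement k S T)

  Run : ℕ → State → State → Set
  Run k = Star (Improvement k)

  steps : ∀ {k S T} → Run k S T → ℕ
  steps {k} = fold {T = Improvement k} (λ _ _ → ℕ) (λ _ → suc) 0

{-# OPTIONS --safe #-}
-- All rectangles have width 1 and the strip width 3.  A tall rectangle, always
-- placed first, fills column 0; the bottom-left rule then puts each further
-- rectangle on the lower of columns 1 and 2.  If D is the difference of these two
-- column loads, a pair of heights a < b with D < a and D < b − a turns D into
-- b − a + D when the smaller one is placed first, and into b − a − D otherwise.
-- So swapping a pair reflects D, as in a reflected binary Gray code: with heights
-- doubling from pair to pair, the 2 ^ m choices for m pairs give distinct final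
-- differences, and walking through the Gray code swaps one pair at a time and
-- strictly decreases the height.  The tall rectangle is exactly as high as the
-- last packing of the walk, which is therefore a global optimum.
module Submission where

open import Defs
open import Data.Nat.Base using (ℕ; _≤_; _*_; _^_)
open import Data.Product.Base using (_×_; ∃-syntax; Σ-syntax)

open import Algebra.Properties.CommutativeSemigroup using (interchange)
open import Data.Bool.Base using (Bool; true; false; if_then_else_)
open import Data.Fin.Base as Fin using (Fin; toℕ; fromℕ<)
open import Data.Fin.Permutation using (permutation; inverseʳ; _⟨$⟩ˡ_)
import Data.Fin.Properties as Fin
import Data.Integer.Base as ℤ
import Data.Integer.Properties as ℤ
open import Data.Nat.Base using (zero; suc; _+_; _<_; z≤n; s≤s; z<s; s<s; s≤s⁻¹)
import Data.Nat.Coprimality as Coprime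
open import Data.Nat.Logarithm using (⌊log₂⌋-mono-≤; ⌊log₂[2^n]⌋≡n)
open import Data.Nat.Properties
open import Data.Product.Base using (_,_; proj₁; proj₂)
open import Data.Rational.Base using (ℚ; mkℚ; 0ℚ; 1ℚ)
import Data.Rational.Base as ℚ
import Data.Rational.Properties as ℚ
open import Data.Sum.Base using (_⊎_; inj₁; inj₂)
open import Data.Vec.Base using (Vec; []; _∷_; replicate; count; tabulate)
import Data.Vec.Functional as Vector
open import Function.Base using (_∘_)
open import Level using (0ℓ)
open import Relation.Binary.Construct.Closure.ReflexiveTransitive
  using (Star; ε; _◅_; _◅◅_; gmap; fold)
open import Relation.Binary.Definitions using (tri<; tri≈; tri>)
open import Relation.Binary.PropositionalEquality
open import Relation.Nullary using (¬_; yes; no; does; contradiction)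
open import Relation.Nullary.Decidable using (¬?; dec-true; dec-false)
open import Relation.Unary using (Pred; Decidable; _⊥_)

-- Natural numbers as rationals

-- Built in lowest terms, so that `ι 0` and `ι 1` compute to `0ℚ` and `1ℚ`, and digit counts can be
-- read off.
ι : ℕ → ℚ
ι a = mkℚ (ℤ.+ a) 0 (Coprime.sym (Coprime.1-coprimeTo a))

ι-+ : ∀ a b → ι a ℚ.+ ι b ≡ ι (a + b)
ι-+ a b = trans
  (cong (ℚ._/ 1) (cong₂ ℤ._+_ (ℤ.*-identityʳ (ℤ.+ a)) (ℤ.*-identityʳ (ℤ.+ b))))
  (ℚ.↥p/↧p≡p (ι (a + b)))

ι-mono-≤ : ∀ {a b} → a ≤ b → ι a ℚ.≤ ι b
ι-mono-≤ a≤b = ℚ.*≤* (ℤ.*-monoʳ-≤-nonNeg ℤ.1ℤ (ℤ.+≤+ a≤b))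

ι-suc : ∀ a → ι a ℚ.+ 1ℚ ≡ ι (suc a)
ι-suc a = trans (ι-+ a 1) (cong ι (+-comm a 1))

ι-suc≤ : ∀ {a b} → a < b → ι a ℚ.+ 1ℚ ℚ.≤ ι b
ι-suc≤ {a} a<b = ℚ.≤-trans (ℚ.≤-reflexive (ι-suc a)) (ι-mono-≤ a<b)

ι-mono-< : ∀ {a b} → a < b → ι a ℚ.< ι b
ι-mono-< a<b = ℚ.*<* (ℤ.*-monoʳ-<-pos ℤ.1ℤ (ℤ.+<+ a<b))

0≤ι : ∀ a → 0ℚ ℚ.≤ ι a
0≤ι a = ι-mono-≤ z≤n

p<p+q : ∀ p {q} → 0ℚ ℚ.< q → p ℚ.< p ℚ.+ q
p<p+q p 0<q = subst (ℚ._< p ℚ.+ _) (ℚ.+-identityʳ p) (ℚ.+-monoʳ-< p 0<q)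

0<1ℚ : 0ℚ ℚ.< 1ℚ
0<1ℚ = ι-mono-< z<s

-- Overlap and disjointness of boxes

-- The larger left end is below the smaller right end; density gives a point between them.
intervals-meet : ∀ {a b c d} → a ℚ.< b → a ℚ.< d → c ℚ.< b → c ℚ.< d →
  ∃[ z ] ((a ℚ.< z × z ℚ.< b) × (c ℚ.< z × z ℚ.< d))
intervals-meet {a} {b} {c} {d} a<b a<d c<b c<d with ℚ.≤-total a c | ℚ.≤-total b d
... | inj₁ a≤c | inj₁ b≤d = let z , l , r = ℚ.<-dense c<b in
  z , (ℚ.≤-<-trans a≤c l , r) , (l , ℚ.<-≤-trans r b≤d)
... | inj₁ a≤c | inj₂ d≤b = let z , l , r = ℚ.<-dense c<d in
  z , (ℚ.≤-<-trans a≤c l , ℚ.<-≤-trans r d≤b) , (l , r)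
... | inj₂ c≤a | inj₁ b≤d = let z , l , r = ℚ.<-dense a<b in
  z , (l , r) , (ℚ.≤-<-trans c≤a l , ℚ.<-≤-trans r b≤d)
... | inj₂ c≤a | inj₂ d≤b = let z , l , r = ℚ.<-dense a<d in
  z , (l , ℚ.<-≤-trans r d≤b) , (ℚ.≤-<-trans c≤a l , r)

UnitBox : ℚ → Point → Pred Point 0ℓ
UnitBox h (x , y) (a , b) =
  (x ℚ.< a × a ℚ.< x ℚ.+ 1ℚ) × (y ℚ.< b × b ℚ.< y ℚ.+ h)

-- The corner `p` lies in the half-open second box, so points slightly above and to the right of it
-- lie in both interiors.
boxes-meet : ∀ h h′ p p′ → 0ℚ ℚ.< h →
  proj₁ p′ ℚ.≤ proj₁ p → proj₁ p ℚ.< proj₁ p′ ℚ.+ 1ℚ →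
  proj₂ p′ ℚ.≤ proj₂ p → proj₂ p ℚ.< proj₂ p′ ℚ.+ h′ →
  ¬ (UnitBox h p ⊥ UnitBox h′ p′)
boxes-meet h h′ (x , y) (x′ , y′) 0<h x′≤x x<x′+1 y′≤y y<y′+h′ disjoint =
  let x<x+1 = p<p+q x 0<1ℚ
      y<y+h = p<p+q y 0<h
      a , a∈ , a∈′ = intervals-meet x<x+1 x<x′+1 (ℚ.≤-<-trans x′≤x x<x+1)
                       (ℚ.≤-<-trans x′≤x x<x′+1)
      b , b∈ , b∈′ = intervals-meet y<y+h y<y′+h′ (ℚ.≤-<-trans y′≤y y<y+h)
                       (ℚ.≤-<-trans y′≤y y<y′+h′)
  in disjoint {a , b} ((a∈ , b∈) , (a∈′ , b∈′))

left-disjoint : ∀ h h′ p p′ → proj₁ p ℚ.+ 1ℚ ℚ.≤ proj₁ p′ →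
  UnitBox h p ⊥ UnitBox h′ p′
left-disjoint h h′ p p′ x+1≤x′ (((_ , a<x+1) , _) , ((x′<a , _) , _)) =
  ℚ.<-irrefl refl (ℚ.<-trans a<x+1 (ℚ.≤-<-trans x+1≤x′ x′<a))

below-disjoint : ∀ h h′ p p′ → proj₂ p ℚ.+ h ℚ.≤ proj₂ p′ →
  UnitBox h p ⊥ UnitBox h′ p′
below-disjoint h h′ p p′ y+h≤y′ ((_ , (_ , b<y+h)) , (_ , (y′<b , _))) =
  ℚ.<-irrefl refl (ℚ.<-trans b<y+h (ℚ.≤-<-trans y+h≤y′ y′<b))

disjoint-sym : ∀ h h′ p p′ → UnitBox h p ⊥ UnitBox h′ p′ → UnitBox h′ p′ ⊥ UnitBox h p
disjoint-sym h h′ p p′ disjoint {q} (q∈′ , q∈) = disjoint {q} (q∈ , q∈′)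

-- The bottom-left rule as list scheduling

-- List scheduling of the jobs H 0 , H 1 , …: job 0 goes to column 0, and every
-- later one to the less loaded of columns 1 and 2.
module Schedule (H : ℕ → ℕ) where

  column : ℕ → ℕ
  load   : ℕ → ℕ → ℕ

  column zero    = 0
  -- A tie goes to column 1, as the rule prefers the smaller x-coordinate.
  column (suc t) = if does (load (suc t) 1 ≤? load (suc t) 2) then 1 else 2

  load zero    c = 0
  load (suc t) c = if does (c ≟ column t) then load t c + H t else load t c

  base : ℕ → ℕ
  base t = load t (column t)

  corner : ℕ → Point
  corner t = ι (column t) , ι (base t)

  column-choice : ∀ t →
      (load (suc t) 1 ≤ load (suc t) 2 × column (suc t) ≡ 1)
    ⊎ (load (suc t) 2 < load (suc t) 1 × column (suc t) ≡ 2)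
  column-choice t with load (suc t) 1 ≤? load (suc t) 2
  ... | yes l≤r = inj₁ (l≤r , cong (λ b → if b then 1 else 2) (dec-true (_ ≤? _) l≤r))
  ... | no  l≰r = inj₂ (≰⇒> l≰r , cong (λ b → if b then 1 else 2) (dec-false (_ ≤? _) l≰r))

  column≤2 : ∀ t → column t ≤ 2
  column≤2 zero = z≤n
  column≤2 (suc t) with column-choice t
  ... | inj₁ (_ , eq) rewrite eq = s≤s z≤n
  ... | inj₂ (_ , eq) rewrite eq = s≤s (s≤s z≤n)

  load-here : ∀ t {c} → c ≡ column t → load (suc t) c ≡ load t c + H t
  load-here t {c} eq = cong (λ b → if b then load t c + H t else load t c)
    (dec-true (c ≟ column t) eq)

  load-elsewhere : ∀ t {c} → c ≢ column t → load (suc t) c ≡ load t c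
  load-elsewhere t {c} neq = cong (λ b → if b then load t c + H t else load t c)
    (dec-false (c ≟ column t) neq)

  load-step : ∀ t c → load t c ≤ load (suc t) c
  load-step t c with c ≟ column t
  ... | yes eq = ≤-trans (m≤m+n _ _) (≤-reflexive (sym (load-here t eq)))
  ... | no neq = ≤-reflexive (sym (load-elsewhere t neq))

  load-mono : ∀ {t u} c → t ≤ u → load t c ≤ load u c
  load-mono {u = zero}  c z≤n = ≤-refl
  load-mono {u = suc u} c t≤u with m≤n⇒m<n∨m≡n t≤u
  ... | inj₁ (s≤s t≤u′) = ≤-trans (load-mono c t≤u′) (load-step u c)
  ... | inj₂ refl       = ≤-refl

  load₀ : ∀ t → load (suc t) 0 ≡ H 0
  load₀ zero    = refl
  load₀ (suc t) with column-choice t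
  ... | inj₁ (_ , eq) = trans (load-elsewhere (suc t) λ 0≡ → contradiction (trans 0≡ eq) λ ()) (load₀ t)
  ... | inj₂ (_ , eq) = trans (load-elsewhere (suc t) λ 0≡ → contradiction (trans 0≡ eq) λ ()) (load₀ t)

  base≤ˡ : ∀ t → base (suc t) ≤ load (suc t) 1
  base≤ˡ t with column-choice t
  ... | inj₁ (_ , eq)   rewrite eq = ≤-refl
  ... | inj₂ (r<l , eq) rewrite eq = <⇒≤ r<l

  base≤ʳ : ∀ t → base (suc t) ≤ load (suc t) 2
  base≤ʳ t with column-choice t
  ... | inj₁ (l≤r , eq) rewrite eq = l≤r
  ... | inj₂ (_ , eq)   rewrite eq = ≤-refl

  top≤load : ∀ {t u} → t < u → base t + H t ≤ load u (column t)
  top≤load {t} t<u = ≤-trans (≤-reflexive (sym (load-here t refl))) (load-mono (column t) t<u)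

  -- Each job starts exactly at the load its column has reached, so a column is stacked without
  -- gaps.
  covered : ∀ u c {y} → 0ℚ ℚ.≤ y → y ℚ.< ι (load u c) →
    ∃[ t ] (t < u × column t ≡ c × ι (base t) ℚ.≤ y × y ℚ.< ι (base t) ℚ.+ ι (H t))
  covered zero c 0≤y y<0 = contradiction (ℚ.≤-<-trans 0≤y y<0) (ℚ.<-irrefl refl)
  covered (suc u) c {y} 0≤y y<load with c ≟ column u
  ... | no neq =
    let t , t<u , rest = covered u c 0≤y
          (subst (λ l → y ℚ.< ι l) (load-elsewhere u neq) y<load)
    in t , m<n⇒m<1+n t<u , rest
  ... | yes refl with y ℚ.<? ι (base u)
  ...   | yes y<base =
    let t , t<u , rest = covered u c 0≤y y<base in t , m<n⇒m<1+n t<u , rest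
  ...   | no  y≮base = u , n<1+n u , refl , ℚ.≮⇒≥ y≮base ,
    subst (y ℚ.<_) (trans (cong ι (load-here u refl)) (sym (ι-+ (base u) (H u)))) y<load

  -- Jobs in different columns lie side by side; in a common column the later one starts at or above
  -- the top of the earlier.
  corners-disjoint : ∀ {t u} → t < u →
    UnitBox (ι (H u)) (corner u) ⊥ UnitBox (ι (H t)) (corner t)
  corners-disjoint {t} {u} t<u with <-cmp (column t) (column u)
  ... | tri< ct<cu _ _ = disjoint-sym (ι (H t)) (ι (H u)) (corner t) (corner u)
    (left-disjoint (ι (H t)) (ι (H u)) (corner t) (corner u) (ι-suc≤ ct<cu))
  ... | tri> _ _ cu<ct = left-disjoint (ι (H u)) (ι (H t)) (corner u) (corner t) (ι-suc≤ cu<ct)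
  ... | tri≈ _ ct≡cu _ = disjoint-sym (ι (H t)) (ι (H u)) (corner t) (corner u)
    (below-disjoint (ι (H t)) (ι (H u)) (corner t) (corner u)
      (ℚ.≤-trans (ℚ.≤-reflexive (ι-+ (base t) (H t)))
        (ι-mono-≤ (≤-trans (top≤load t<u) (≤-reflexive (cong (load u) ct≡cu))))))

  FitsAt : ℕ → ℚ → Pred Point 0ℓ
  FitsAt u h (x , y) = 0ℚ ℚ.≤ x × x ℚ.+ 1ℚ ℚ.≤ ι 3 × 0ℚ ℚ.≤ y
    × (∀ t → t < u → UnitBox h (x , y) ⊥ UnitBox (ι (H t)) (corner t))

  corner-fits : ∀ u → FitsAt u (ι (H u)) (corner u)
  corner-fits u = 0≤ι (column u)
    , ι-suc≤ (s≤s (column≤2 u))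
    , 0≤ι (base u)
    , λ t → corners-disjoint

  -- The x-coordinate need not be integral: the corner still lies in the half-open column `c`, so
  -- below the load it would fall into a stacked job and the boxes would meet.
  above-load : ∀ {u h x y} c → 0ℚ ℚ.< h → FitsAt u h (x , y) →
    ι c ℚ.≤ x → x ℚ.< ι (suc c) → ι (load u c) ℚ.≤ y
  above-load {u} {h} {x} {y} c 0<h (_ , _ , 0≤y , free) c≤x x<c+1
    with y ℚ.<? ι (load u c)
  ... | no  y≮load = ℚ.≮⇒≥ y≮load
  ... | yes y<load with covered u c 0≤y y<load
  ...   | t , t<u , refl , base≤y , y<top = contradiction (λ {pt} → free t t<u {pt})
    (boxes-meet h (ι (H t)) (x , y) (corner t) 0<h c≤x
      (ℚ.<-≤-trans x<c+1 (ℚ.≤-reflexive (sym (ι-suc (column t)))))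
      base≤y y<top)

  in-some-column : ∀ {u h x y} → FitsAt u h (x , y) →
    x ℚ.< ι 1 ⊎ (ι 1 ℚ.≤ x × x ℚ.< ι 2) ⊎ (ι 2 ℚ.≤ x × x ℚ.< ι 3)
  in-some-column {x = x} (_ , x+1≤3 , _) with x ℚ.<? ι 1 | x ℚ.<? ι 2
  ... | yes x<1 | _       = inj₁ x<1
  ... | no  x≮1 | yes x<2 = inj₂ (inj₁ (ℚ.≮⇒≥ x≮1 , x<2))
  ... | no  _   | no  x≮2 = inj₂ (inj₂ (ℚ.≮⇒≥ x≮2 , ℚ.<-≤-trans (p<p+q x 0<1ℚ) x+1≤3))

  -- The hypothesis on `H 0` rules out column 0, where any position is above job 0 and so strictly
  -- too high. In columns 1 and 2 no position is lower than the smaller load, and ties are settled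
  -- by x.
  corner-least : ∀ u {h x y} → 0ℚ ℚ.< h → (0 < u → base u < H 0) → FitsAt u h (x , y) →
    ι (base u) ℚ.< y ⊎ (ι (base u) ≡ y × ι (column u) ℚ.≤ x)
  corner-least zero {y = y} 0<h _ (0≤x , _ , 0≤y , _) with ℚ.<-cmp 0ℚ y
  ... | tri< 0<y _ _ = inj₁ 0<y
  ... | tri≈ _ 0≡y _ = inj₂ (0≡y , 0≤x)
  ... | tri> _ _ y<0 = contradiction (ℚ.≤-<-trans 0≤y y<0) (ℚ.<-irrefl refl)
  corner-least (suc u) {h} {x} {y} 0<h low fits@(0≤x , _) with in-some-column fits
  ... | inj₁ x<1 = inj₁ (ℚ.<-≤-trans (ι-mono-< (low z<s))
    (subst (λ l → ι l ℚ.≤ y) (load₀ u) (above-load 0 0<h fits 0≤x x<1)))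
  ... | inj₂ (inj₂ (2≤x , x<3)) with ℚ.<-cmp (ι (base (suc u))) y
  ...   | tri< b<y _ _ = inj₁ b<y
  ...   | tri≈ _ b≡y _ = inj₂ (b≡y , ℚ.≤-trans (ι-mono-≤ (column≤2 (suc u))) 2≤x)
  ...   | tri> _ _ y<b = contradiction
    (ℚ.<-≤-trans y<b (ℚ.≤-trans (ι-mono-≤ (base≤ʳ u)) (above-load 2 0<h fits 2≤x x<3)))
    (ℚ.<-irrefl refl)
  corner-least (suc u) {h} {x} {y} 0<h low fits@(0≤x , _) | inj₂ (inj₁ (1≤x , x<2))
    with column-choice u
  ...   | inj₂ (r<l , eq) = inj₁ (ℚ.<-≤-trans
    (ι-mono-< (subst (λ c → load (suc u) c < load (suc u) 1) (sym eq) r<l))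
    (above-load 1 0<h fits 1≤x x<2))
  ...   | inj₁ (_ , eq) with ℚ.<-cmp (ι (base (suc u))) y
  ...     | tri< b<y _ _ = inj₁ b<y
  ...     | tri≈ _ b≡y _ = inj₂ (b≡y , subst (λ c → ι c ℚ.≤ x) (sym eq) 1≤x)
  ...     | tri> _ _ y<b = contradiction
    (ℚ.<-≤-trans y<b (ℚ.≤-trans (ι-mono-≤ (base≤ˡ u)) (above-load 1 0<h fits 1≤x x<2)))
    (ℚ.<-irrefl refl)

  -- The pair is unordered, since only the smaller and the larger load matter, not which column
  -- carries them.
  Loads : ℕ → ℕ → ℕ → Set
  Loads u p q = (load u 1 ≡ p × load u 2 ≡ q) ⊎ (load u 1 ≡ q × load u 2 ≡ p)

  Loads-sym : ∀ u {p q} → Loads u p q → Loads u q p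
  Loads-sym u (inj₁ l≡r) = inj₂ l≡r
  Loads-sym u (inj₂ l≡r) = inj₁ l≡r

  Loads-step : ∀ u {p q h} → H (suc u) ≡ h → p < q →
    Loads (suc u) p q → Loads (suc (suc u)) (p + h) q
  Loads-step u refl p<q loads with column-choice u | loads
  ... | inj₁ (_ , eq) | inj₁ (refl , refl) = inj₁
    (load-here (suc u) (sym eq) , load-elsewhere (suc u) λ 2≡ → contradiction (trans 2≡ eq) λ ())
  ... | inj₂ (_ , eq) | inj₂ (refl , refl) = inj₂
    (load-elsewhere (suc u) (λ 1≡ → contradiction (trans 1≡ eq) λ ()) , load-here (suc u) (sym eq))
  ... | inj₁ (l≤r , _) | inj₂ (refl , refl) = contradiction p<q (≤⇒≯ l≤r)
  ... | inj₂ (r<l , _) | inj₁ (refl , refl) = contradiction p<q (<-asym r<l)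

  larger-load : ∀ u {p q} (P : ℕ → Set) → Loads u p q → (∀ c → P (load u c)) → P q
  larger-load u P (inj₁ (_ , refl)) all = all 2
  larger-load u P (inj₂ (refl , _)) all = all 1

  load≤larger : ∀ u {p q} → Loads u p q → p ≤ q → ∀ t → load u (column (suc t)) ≤ q
  load≤larger u loads p≤q t with column-choice t | loads
  ... | inj₁ (_ , eq) | inj₁ (refl , _) rewrite eq = p≤q
  ... | inj₁ (_ , eq) | inj₂ (refl , _) rewrite eq = ≤-refl
  ... | inj₂ (_ , eq) | inj₁ (_ , refl) rewrite eq = ≤-refl
  ... | inj₂ (_ , eq) | inj₂ (_ , refl) rewrite eq = p≤q

  -- A start is at most either load of its moment, and loads never decrease.
  base≤smaller : ∀ u {p q} → Loads u p q → ∀ {t} → suc t ≤ u → base (suc t) ≤ p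
  base≤smaller u (inj₁ (refl , _)) {t} t<u = ≤-trans (base≤ˡ t) (load-mono 1 t<u)
  base≤smaller u (inj₂ (_ , refl)) {t} t<u = ≤-trans (base≤ʳ t) (load-mono 2 t<u)

-- Swapping adjacent pairs of places

swapPairs : (ℕ → Bool) → ℕ → ℕ
swapPairs β zero          = if β 0 then 1 else 0
swapPairs β (suc zero)    = if β 0 then 0 else 1
swapPairs β (suc (suc t)) = suc (suc (swapPairs (β ∘ suc) t))

swapPairs-involutive : ∀ β t → swapPairs β (swapPairs β t) ≡ t
swapPairs-involutive β zero with β 0 in eq
... | true  rewrite eq = refl
... | false rewrite eq = refl
swapPairs-involutive β (suc zero) with β 0 in eq
... | true  rewrite eq = refl
... | false rewrite eq = refl
swapPairs-involutive β (suc (suc t)) = cong (suc ∘ suc) (swapPairs-involutive (β ∘ suc) t)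

swapPairs-< : ∀ β m {t} → t < m * 2 → swapPairs β t < m * 2
swapPairs-< β (suc m) {zero} _ with β 0
... | true  = s<s z<s
... | false = z<s
swapPairs-< β (suc m) {suc zero} _ with β 0
... | true  = z<s
... | false = s<s z<s
swapPairs-< β (suc m) {suc (suc t)} (s<s (s<s t<)) = s<s (s<s (swapPairs-< (β ∘ suc) m t<))

swapPairs-even : ∀ β i → swapPairs β (i * 2) ≡ (if β i then suc (i * 2) else i * 2)
swapPairs-even β zero = refl
swapPairs-even β (suc i) with β (suc i) | swapPairs-even (β ∘ suc) i
... | true  | eq = cong (suc ∘ suc) eq
... | false | eq = cong (suc ∘ suc) eq

swapPairs-odd : ∀ β i → swapPairs β (suc (i * 2)) ≡ (if β i then i * 2 else suc (i * 2))
swapPairs-odd β zero = refl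
swapPairs-odd β (suc i) with β (suc i) | swapPairs-odd (β ∘ suc) i
... | true  | eq = cong (suc ∘ suc) eq
... | false | eq = cong (suc ∘ suc) eq

-- Each bit governs only its own two places. Hence changing one bit moves at most two rectangles.
swapPairs-local : ∀ {β β′} i → (∀ j → j ≢ i → β j ≡ β′ j) → ∀ t →
  swapPairs β t ≢ swapPairs β′ t → t ≡ i * 2 ⊎ t ≡ suc (i * 2)
swapPairs-local zero    agree zero          _    = inj₁ refl
swapPairs-local zero    agree (suc zero)    _    = inj₂ refl
swapPairs-local (suc i) agree zero          diff =
  contradiction (cong (λ b → if b then 1 else 0) (agree 0 λ ())) diff
swapPairs-local (suc i) agree (suc zero)    diff =
  contradiction (cong (λ b → if b then 0 else 1) (agree 0 λ ())) diff
swapPairs-local {β} {β′} zero agree (suc (suc t)) diff =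
  contradiction (cong (suc ∘ suc) (swapPairs-cong {t = t} λ j → agree (suc j) λ ())) diff
  where
  swapPairs-cong : ∀ {β β′ t} → (∀ j → β j ≡ β′ j) → swapPairs β t ≡ swapPairs β′ t
  swapPairs-cong {t = zero}        eq = cong (λ b → if b then 1 else 0) (eq 0)
  swapPairs-cong {t = suc zero}    eq = cong (λ b → if b then 0 else 1) (eq 0)
  swapPairs-cong {t = suc (suc t)} eq = cong (suc ∘ suc) (swapPairs-cong {t = t} (eq ∘ suc))
swapPairs-local (suc i) agree (suc (suc t)) diff
  with swapPairs-local i (λ j j≢i → agree (suc j) (j≢i ∘ suc-injective)) t (diff ∘ cong (suc ∘ suc))
... | inj₁ refl = inj₁ refl
... | inj₂ refl = inj₂ refl

-- Heights of the pairs

-- The sequence 2, 4, 4, 8, 8, 16, ...: pair `i` has the heights 2^(i+1) and 2^(i+2).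
pairHeight : ℕ → ℕ
pairHeight zero          = 2
pairHeight (suc zero)    = 4
pairHeight (suc (suc t)) = 2 * pairHeight t

small big : ℕ → ℕ
small i = pairHeight (i * 2)
big   i = pairHeight (suc (i * 2))

pairHeight>0 : ∀ t → 0 < pairHeight t
pairHeight>0 zero          = z<s
pairHeight>0 (suc zero)    = z<s
pairHeight>0 (suc (suc t)) = *-mono-≤ {1} {2} {1} (s≤s z≤n) (pairHeight>0 t)

pairHeight≤2^ : ∀ t → pairHeight t ≤ 2 ^ (2 + t)
pairHeight≤2^ zero          = s≤s (s≤s z≤n)
pairHeight≤2^ (suc zero)    = s≤s (s≤s (s≤s (s≤s z≤n)))
pairHeight≤2^ (suc (suc t)) = *-monoʳ-≤ 2 (≤-trans (pairHeight≤2^ t) (^-monoʳ-≤ 2 (n≤1+n (2 + t))))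

big≡small+small : ∀ i → big i ≡ small i + small i
big≡small+small zero    = refl
big≡small+small (suc i) = begin
  2 * big i             ≡⟨ cong (2 *_) (big≡small+small i) ⟩
  2 * (small i + small i) ≡⟨ *-distribˡ-+ 2 (small i) (small i) ⟩
  2 * small i + 2 * small i ∎
  where open ≡-Reasoning

big≡small : ∀ i → big i ≡ small (suc i)
big≡small i = trans (big≡small+small i) (cong (small i +_) (sym (+-identityʳ (small i))))

-- Words and the loads they produce

-- A word lists the pairs from the last placed to the first; true means that the
-- bigger rectangle of the pair precedes the smaller one.
Word : ℕ → Set
Word = Vec Bool

-- Indices of a word start at 1, its head having the largest. Bit 0 stays `false`: it belongs to the
-- tall job and the job of height 1, which are never swapped.
bit : ∀ {m} → Word m → ℕ → Bool
bit []              i = false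
bit {suc m} (b ∷ g) i = if does (i ≟ suc m) then b else bit g i

bit-tail : ∀ {m} b (g : Word m) {i} → i ≢ suc m → bit (b ∷ g) i ≡ bit g i
bit-tail {m} b g {i} i≢ = cong (λ x → if x then b else bit g i) (dec-false (i ≟ suc m) i≢)

bit-head : ∀ {m} b (g : Word m) → bit (b ∷ g) (suc m) ≡ b
bit-head {m} b g = cong (λ x → if x then b else bit g (suc m)) (dec-true (suc m ≟ suc m) refl)

bit₀ : ∀ {m} (g : Word m) → bit g 0 ≡ false
bit₀ []      = refl
bit₀ (b ∷ g) = bit₀ g

-- The smaller and the larger load of columns 1 and 2 after all pairs of a word.
lo hi : ∀ {m} → Word m → ℕ
lo []                  = 0
lo {suc m} (false ∷ g) = lo g + small m
lo {suc m} (true  ∷ g) = hi g + small m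
hi []                  = 1
hi {suc m} (false ∷ g) = hi g + big m
hi {suc m} (true  ∷ g) = lo g + big m

small<big : ∀ m → small m < big m
small<big m = begin-strict
  small m           <⟨ m<m+n (small m) (pairHeight>0 (m * 2)) ⟩
  small m + small m ≡⟨ big≡small+small m ⟨
  big m             ∎
  where open ≤-Reasoning

-- Let D be `hi g` minus `lo g` and a be `small m`. The next pair turns D into a + D or a - D; as 0
-- < D < a, both lie strictly between 0 and 2a, which is `small (suc m)`.
gap : ∀ {m} (g : Word m) → lo g < hi g × hi g < lo g + small m
gap [] = z<s , s<s z<s
gap {suc m} (b ∷ g) with gap g
gap {suc m} (false ∷ g) | lo<hi , hi<lo+ =
    +-mono-< lo<hi (small<big m)
  , +-mono-<-≤ hi<lo+ (≤-reflexive (big≡small m))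
gap {suc m} (true ∷ g) | lo<hi , hi<lo+ =
    (begin-strict
      hi g + small m             <⟨ +-monoˡ-< (small m) hi<lo+ ⟩
      lo g + small m + small m   ≡⟨ +-assoc (lo g) (small m) (small m) ⟩
      lo g + (small m + small m) ≡⟨ cong (lo g +_) (big≡small+small m) ⟨
      lo g + big m ∎)
  , (begin-strict
      lo g + big m                   <⟨ +-monoˡ-< (big m) lo<hi ⟩
      hi g + big m                   ≡⟨ cong (hi g +_) (big≡small m) ⟩
      hi g + small (suc m)           ≤⟨ +-monoˡ-≤ (small (suc m)) (m≤m+n (hi g) (small m)) ⟩
      hi g + small m + small (suc m) ∎)
  where open ≤-Reasoning

lo<hi : ∀ {m} (g : Word m) → lo g < hi g
lo<hi g = proj₁ (gap g)

hi≤2^ : ∀ {m} (g : Word m) → hi g ≤ 2 ^ (suc m * 2)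
hi≤2^ [] = s≤s z≤n
hi≤2^ {suc m} (b ∷ g) = begin
  hi (b ∷ g)       ≤⟨ hi-head b ⟩
  hi g + big m     ≤⟨ +-mono-≤ (hi≤2^ g) big≤ ⟩
  B + 2 * B        ≤⟨ m≤n+m (B + 2 * B) B ⟩
  B + (B + 2 * B)  ≡⟨ +-assoc B B (2 * B) ⟨
  B + B + 2 * B    ≡⟨ cong (λ x → B + x + 2 * B) (+-identityʳ B) ⟨
  2 * B + 2 * B    ≡⟨ cong (2 * B +_) (+-identityʳ (2 * B)) ⟨
  2 * (2 * B)      ∎
  where
  open ≤-Reasoning
  B = 2 ^ (suc m * 2)
  hi-head : ∀ b → hi (b ∷ g) ≤ hi g + big m
  hi-head false = ≤-refl
  hi-head true  = +-monoˡ-≤ (big m) (<⇒≤ (lo<hi g))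
  big≤ : big m ≤ 2 * B
  big≤ = pairHeight≤2^ (suc (m * 2))

-- Either order of a pair adds the same two heights to the two columns.
lo+hi : ∀ {m} (g g′ : Word m) → lo g + hi g ≡ lo g′ + hi g′
lo+hi [] [] = refl
lo+hi {suc m} (b ∷ g) (b′ ∷ g′) = begin
  lo (b ∷ g) + hi (b ∷ g)           ≡⟨ head b g ⟩
  (lo g + hi g) + (small m + big m)     ≡⟨ cong (_+ (small m + big m)) (lo+hi g g′) ⟩
  (lo g′ + hi g′) + (small m + big m)   ≡⟨ head b′ g′ ⟨
  lo (b′ ∷ g′) + hi (b′ ∷ g′)       ∎
  where
  open ≡-Reasoning
  head : ∀ b (g : Word m) → lo (b ∷ g) + hi (b ∷ g) ≡ (lo g + hi g) + (small m + big m)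
  head false g = interchange +-commutativeSemigroup (lo g) (small m) (hi g) (big m)
  head true  g = trans (interchange +-commutativeSemigroup (hi g) (small m) (lo g) (big m))
    (cong (_+ (small m + big m)) (+-comm (hi g) (lo g)))

-- The Gray code and its length

-- The reflected Gray code. Since true reflects the gap hi − lo of the tail, the
-- words below a leading true are passed through backwards.
data Down : ∀ {m} → Word m → Word m → Set where
  flip       : ∀ {m} {g : Word m} → Down (false ∷ g) (true ∷ g)
  keep-false : ∀ {m} {g g′ : Word m} → Down g g′ → Down (false ∷ g) (false ∷ g′)
  keep-true  : ∀ {m} {g g′ : Word m} → Down g′ g → Down (true ∷ g) (true ∷ g′)

-- Both inequalities go through one induction: a leading `true` exchanges `lo` and `hi`, so in
-- `keep-true` each follows from the other one for the tails.
down-narrows : ∀ {m} {g g′ : Word m} → Down g g′ → hi g′ < hi g × lo g < lo g′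
down-narrows (flip {m} {g}) = +-monoˡ-< (big m) (lo<hi g) , +-monoˡ-< (small m) (lo<hi g)
down-narrows {suc m} (keep-false d) =
  let hi< , lo< = down-narrows d in +-monoˡ-< (big m) hi< , +-monoˡ-< (small m) lo<
down-narrows {suc m} (keep-true d) =
  let hi< , lo< = down-narrows d in +-monoˡ-< (big m) lo< , +-monoˡ-< (small m) hi<

down-flips-one-bit : ∀ {m} {g g′ : Word m} → Down g g′ →
  ∃[ i ] (∀ j → j ≢ i → bit g j ≡ bit g′ j)
down-flips-one-bit (flip {m} {g}) =
  suc m , λ j j≢ → trans (bit-tail false g j≢) (sym (bit-tail true g j≢))
down-flips-one-bit {suc m} (keep-false d) = let i , agree = down-flips-one-bit d in
  i , λ j j≢ → cong (if does (j ≟ suc m) then false else_) (agree j j≢)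
down-flips-one-bit {suc m} (keep-true d) = let i , agree = down-flips-one-bit d in
  i , λ j j≢ → cong (if does (j ≟ suc m) then true else_) (sym (agree j (j≢)))

length : ∀ {A : Set} {R : A → A → Set} {x y} → Star R x y → ℕ
length {R = R} = fold {T = R} (λ _ _ → ℕ) (λ _ → suc) 0

length-◅◅ : ∀ {A : Set} {R : A → A → Set} {x y z} (r : Star R x y) (s : Star R y z) →
  length (r ◅◅ s) ≡ length r + length s
length-◅◅ ε       s = refl
length-◅◅ (_ ◅ r) s = cong suc (length-◅◅ r s)

length-gmap : ∀ {A B : Set} {R : A → A → Set} {S : B → B → Set} {x y}
  (f : A → B) (k : ∀ {x y} → R x y → S (f x) (f y)) (r : Star R x y) →
  length (gmap {U = S} f k r) ≡ length r
length-gmap f k ε       = refl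
length-gmap f k (_ ◅ r) = cong suc (length-gmap f k r)

-- The doubling step: two walks, carried over to words one bit longer and bridged by a single step.
join-long : ∀ {A B : Set} {R S : A → A → Set} {T : B → B → Set} {f g : A → B} {l x y z w} →
  (∀ {x y} → R x y → T (f x) (f y)) → T (f y) (g z) → (∀ {x y} → S x y → T (g x) (g y)) →
  Σ[ r ∈ Star R x y ] l ≤ length r → Σ[ s ∈ Star S z w ] l ≤ length s →
  Σ[ q ∈ Star T (f x) (g w) ] 2 * l ≤ length q
join-long {T = T} {f} {g} {l} R⇒T joint S⇒T (r , r-long) (s , s-long) =
  r′ ◅◅ joint ◅ s′ , (begin
    l + (l + 0)                 ≡⟨ cong (l +_) (+-identityʳ l) ⟩
    l + l                       ≤⟨ +-mono-≤ r-long s-long ⟩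
    length r + length s         ≡⟨ cong₂ _+_ (length-gmap f R⇒T r) (length-gmap g S⇒T s) ⟨
    length r′ + length s′       ≤⟨ +-monoʳ-≤ (length r′) (n≤1+n (length s′)) ⟩
    length r′ + suc (length s′) ≡⟨ length-◅◅ r′ (joint ◅ s′) ⟨
    length (r′ ◅◅ joint ◅ s′)   ∎)
  where
  open ≤-Reasoning
  r′ = gmap {U = T} f R⇒T r
  s′ = gmap {U = T} g S⇒T s

top : ∀ m → Word m
top m = replicate m false

-- The last word of the reflected Gray code that starts with all bits `false`.
bottom : ∀ m → Word (suc m)
bottom m = true ∷ top m

Up : ∀ {m} → Word m → Word m → Set
Up g g′ = Down g′ g

-- Under a leading `false` the tail walks down; after the flip a leading `true` reverses the
-- direction, so the tail walks back up. All 2^(m+1) words are visited; the bound 2^m is cruder but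
-- doubles exactly.
gray-down : ∀ m → Σ[ r ∈ Star Down (top (suc m)) (bottom m) ] 2 ^ m ≤ length r
gray-up   : ∀ m → Σ[ r ∈ Star Up (bottom m) (top (suc m)) ] 2 ^ m ≤ length r

gray-down zero    = flip ◅ ε , s≤s z≤n
gray-down (suc m) =
  join-long keep-false flip keep-true (gray-down m) (gray-up m)
gray-up zero    = flip ◅ ε , s≤s z≤n
gray-up (suc m) =
  join-long {T = Up} keep-true flip keep-false (gray-down m) (gray-up m)

-- The most balanced word

top-gap : ∀ m → suc (hi (top m)) ≡ lo (top m) + small m
top-gap zero    = refl
top-gap (suc m) = cong₂ _+_ (top-gap m) (big≡small m)

-- The tail, all `false`, has gap `small m` - 1, the largest that `gap` allows; reflecting it leaves
-- gap 1.
bottom-gap : ∀ m → hi (bottom m) ≡ suc (lo (bottom m))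
bottom-gap m = begin
  lo (top m) + big m               ≡⟨ cong (lo (top m) +_) (big≡small+small m) ⟩
  lo (top m) + (small m + small m) ≡⟨ +-assoc (lo (top m)) (small m) (small m) ⟨
  lo (top m) + small m + small m   ≡⟨ cong (_+ small m) (top-gap m) ⟨
  suc (hi (top m) + small m)       ∎
  where open ≡-Reasoning

-- Consecutive numbers split a sum most evenly, so any other pair a < b with that sum encloses them.
balanced-extremal : ∀ {a b c d} → a + b ≡ c + d → a < b → d ≡ suc c → a < d × d ≤ b
balanced-extremal {a} {b} {c} {d} sum a<b refl = s≤s a≤c , c<b
  where
  a≤c : a ≤ c
  a≤c = ≮⇒≥ λ c<a → <-irrefl (sym sum) (+-mono-< c<a (≤-<-trans c<a a<b))
  c<b : c < b
  c<b = ≰⇒> λ b≤c → <-irrefl sum (+-mono-<-≤ (<-≤-trans a<b b≤c) (m≤n⇒m≤1+n b≤c))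

-- With a tall job of height `hi (bottom m)`, this keeps all later jobs off column 0.
lo<bottom : ∀ {m} (g : Word (suc m)) → lo g < hi (bottom m)
lo<bottom {m} g = proj₁ (balanced-extremal (lo+hi g (bottom m)) (lo<hi g) (bottom-gap m))

-- Hence the tall job never rises above the larger of the other two loads.
bottom≤hi : ∀ {m} (g : Word (suc m)) → hi (bottom m) ≤ hi g
bottom≤hi {m} g = proj₂ (balanced-extremal (lo+hi g (bottom m)) (lo<hi g) (bottom-gap m))

-- Loads of the schedule given by a word

-- The tall job and the job of height 1 form pair 0, so pair `i` of `pairHeight` becomes pair
-- `suc i`.
jobHeight : ℕ → ℕ → ℕ
jobHeight K zero          = K
jobHeight K (suc zero)    = 1
jobHeight K (suc (suc t)) = pairHeight t

module _ (K : ℕ) (β : ℕ → Bool) (β₀ : β 0 ≡ false) where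
  open Schedule (jobHeight K ∘ swapPairs β)

  initial-loads : Loads 2 0 1
  -- Columns 1 and 2 are tied at 0 when the job of height 1 arrives, so it goes to column 1.
  initial-loads rewrite β₀ = inj₂ (refl , refl)

  -- The first job of a pair goes onto the smaller load and, exceeding the gap, makes it the larger;
  -- so the second job goes to the other column. As `β` stays fixed while `g` shrinks to its tails,
  -- agreement is asked only up to `m`.
  word-loads : ∀ {m} (g : Word m) → (∀ i → i ≤ m → β i ≡ bit g i) →
    Loads (suc m * 2) (lo g) (hi g)
  word-loads [] _ = initial-loads
  word-loads {suc m} (b ∷ g) agree = pair b (trans (agree (suc m) ≤-refl) (bit-head b g))
    where
    t = suc (m * 2)
    tail : Loads (suc t) (lo g) (hi g)
    tail = word-loads g λ i i≤m →
      trans (agree i (m≤n⇒m≤1+n i≤m)) (bit-tail b g (<⇒≢ (s≤s i≤m)))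
    first : ∀ {b} → β (suc m) ≡ b →
      jobHeight K (swapPairs β (suc m * 2)) ≡ pairHeight (if b then suc (m * 2) else m * 2)
    first eq = cong pairHeight (trans (swapPairs-even (β ∘ suc) m)
      (cong (if_then suc (m * 2) else (m * 2)) eq))
    second : ∀ {b} → β (suc m) ≡ b →
      jobHeight K (swapPairs β (suc (suc m * 2))) ≡ pairHeight (if b then m * 2 else suc (m * 2))
    second eq = cong pairHeight (trans (swapPairs-odd (β ∘ suc) m)
      (cong (if_then m * 2 else suc (m * 2)) eq))
    hi<lo+big : hi g < lo g + big m
    hi<lo+big = <-trans (proj₂ (gap g)) (+-monoʳ-< (lo g) (small<big m))
    pair : ∀ b → β (suc m) ≡ b → Loads (suc (suc m) * 2) (lo (b ∷ g)) (hi (b ∷ g))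
    pair false eq = Loads-sym (3 + t) (Loads-step (suc t) (second eq) (proj₂ (gap g))
      (Loads-sym (2 + t) (Loads-step t (first eq) (lo<hi g) tail)))
    pair true eq = Loads-step (suc t) (second eq) hi<lo+big
      (Loads-sym (2 + t) (Loads-step t (first eq) (lo<hi g) tail))

-- Maxima, sums, counts and digits

foldr-⊔-lub : ∀ {n} (f : Fin n → ℚ) {B} → 0ℚ ℚ.≤ B → (∀ i → f i ℚ.≤ B) →
  Vector.foldr ℚ._⊔_ 0ℚ f ℚ.≤ B
foldr-⊔-lub {zero}  f 0≤B f≤B = 0≤B
foldr-⊔-lub {suc n} f 0≤B f≤B =
  ℚ.⊔-lub (f≤B Fin.zero) (foldr-⊔-lub (f ∘ Fin.suc) 0≤B (f≤B ∘ Fin.suc))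

≤-foldr-⊔ : ∀ {n} (f : Fin n → ℚ) i → f i ℚ.≤ Vector.foldr ℚ._⊔_ 0ℚ f
≤-foldr-⊔ f Fin.zero    = ℚ.p≤p⊔q _ _
≤-foldr-⊔ f (Fin.suc i) = ℚ.≤-trans (≤-foldr-⊔ (f ∘ Fin.suc) i) (ℚ.p≤q⊔p (f Fin.zero) _)

height-lub : ∀ I (p : Packing I) {B} → 0ℚ ℚ.≤ B →
  (∀ i → proj₂ (p i) ℚ.+ Instance.h I i ℚ.≤ B) → height I p ℚ.≤ B
height-lub I p = foldr-⊔-lub (λ i → proj₂ (p i) ℚ.+ Instance.h I i)

top≤height : ∀ I (p : Packing I) i → proj₂ (p i) ℚ.+ Instance.h I i ℚ.≤ height I p
top≤height I p = ≤-foldr-⊔ (λ i → proj₂ (p i) ℚ.+ Instance.h I i)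

foldr-+-≤ : ∀ {n} (f : Fin n → ℕ) {B} → (∀ i → f i ≤ B) → Vector.foldr _+_ 0 f ≤ n * B
foldr-+-≤ {zero}  f f≤B = z≤n
foldr-+-≤ {suc n} f f≤B = +-mono-≤ (f≤B Fin.zero) (foldr-+-≤ (f ∘ Fin.suc) (f≤B ∘ Fin.suc))

-- Bounds `moved` for two orderings that differ only within one pair of adjacent places.
count-window : ∀ {A : Set} {P : Pred A 0ℓ} (P? : Decidable P) {n} (f : Fin n → A) a k →
  (∀ t → P (f t) → a ≤ toℕ t × toℕ t < a + k) → count P? (tabulate f) ≤ k
count-window P? {zero}  f a k window = z≤n
count-window P? {suc n} f a k window with P? (f Fin.zero)
count-window P? {suc n} f (suc a) k window | no _ =
  count-window P? (f ∘ Fin.suc) a k λ t Pt →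
    let a≤t , t<a+k = window (Fin.suc t) Pt in s≤s⁻¹ a≤t , s≤s⁻¹ t<a+k
count-window P? {suc n} f zero k window | no _ =
  count-window P? (f ∘ Fin.suc) zero k λ t Pt →
    z≤n , <-trans (n<1+n (toℕ t)) (proj₂ (window (Fin.suc t) Pt))
count-window P? {suc n} f zero (suc k) window | yes _ =
  s≤s (count-window P? (f ∘ Fin.suc) zero k λ t Pt →
    z≤n , s≤s⁻¹ (proj₂ (window (Fin.suc t) Pt)))
count-window P? {suc n} f zero zero window | yes P₀ =
  contradiction (proj₂ (window Fin.zero P₀)) λ ()
count-window P? {suc n} f (suc a) k window | yes P₀ =
  contradiction (proj₁ (window Fin.zero P₀)) λ ()

bits≤ : ∀ {a n} → a ≤ 2 ^ n → bits a ≤ suc n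
bits≤ {n = n} a≤2^n = s≤s (≤-trans (⌊log₂⌋-mono-≤ a≤2^n) (≤-reflexive (⌊log₂[2^n]⌋≡n n)))

-- The instance and its states

module Construction (m : ℕ) where
  -- A word of length `suc m` governs `suc m` pairs; pair 0 is one more.
  n K : ℕ
  n = suc (suc m) * 2
  K = hi (bottom m)

  jobHeight>0 : ∀ t → 0 < jobHeight K t
  jobHeight>0 zero          = ≤-<-trans z≤n (lo<hi (bottom m))
  jobHeight>0 (suc zero)    = z<s
  jobHeight>0 (suc (suc t)) = pairHeight>0 t

  inst : Instance
  inst = record
    { W   = ι 3
    ; n   = n
    ; w   = λ _ → 1ℚ
    ; h   = λ i → ι (jobHeight K (toℕ i))
    ; 0<W = ι-mono-< z<s
    ; 0<w = λ _ → 0<1ℚ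
    ; w≤W = λ _ → ι-mono-≤ (s≤s z≤n)
    ; 0<h = λ i → ι-mono-< (jobHeight>0 (toℕ i))
    }

  jobHeight≤2^n : ∀ t → t < n → jobHeight K t ≤ 2 ^ n
  jobHeight≤2^n zero          _   = hi≤2^ (bottom m)
  jobHeight≤2^n (suc zero)    _   = m^n>0 2 n
  jobHeight≤2^n (suc (suc t)) t<n = ≤-trans (pairHeight≤2^ t) (^-monoʳ-≤ 2 (<⇒≤ t<n))

  encodingLength-poly : encodingLength inst ≤ 8 * n ^ 8
  encodingLength-poly = begin
    -- The strip width takes 3 digits. Each job takes 2 for its width, at most `suc n` for the
    -- numerator of its height and 1 for the denominator.
    encodingLength inst            ≤⟨ +-monoʳ-≤ 3 (foldr-+-≤ {n} _ size≤) ⟩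
    3 + n * (n + 4)                ≡⟨ cong (3 +_) (*-distribˡ-+ n n 4) ⟩
    3 + (n * n + n * 4)            ≤⟨ +-mono-≤ (*-monoʳ-≤ 3 (*-mono-≤ 1≤n 1≤n))
                                        (+-monoʳ-≤ (n * n) (*-monoˡ-≤ 4 (m≤m*n n n))) ⟩
    3 * (n * n) + (n * n + n * n * 4) ≡⟨ cong (λ x → 3 * (n * n) + (n * n + x)) (*-comm (n * n) 4) ⟩
    3 * (n * n) + 5 * (n * n)      ≡⟨ *-distribʳ-+ (n * n) 3 5 ⟨
    8 * (n * n)                    ≡⟨ cong (λ x → 8 * (n * x)) (*-identityʳ n) ⟨
    -- The exponent is raised to equal the coefficient, as a single `d` serves for both.
    8 * n ^ 2                      ≤⟨ *-monoʳ-≤ 8 (^-monoʳ-≤ n {2} {8} (s≤s (s≤s z≤n))) ⟩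
    8 * n ^ 8                      ∎
    where
    open ≤-Reasoning
    1≤n : 1 ≤ n
    1≤n = s≤s z≤n
    size≤ : ∀ i → 2 + (bits (jobHeight K (toℕ i)) + 1) ≤ n + 4
    size≤ i = begin
      2 + (bits (jobHeight K (toℕ i)) + 1) ≤⟨ +-monoʳ-≤ 2 (+-monoˡ-≤ 1 (bits≤ {n = n} (jobHeight≤2^n _ (Fin.toℕ<n i)))) ⟩
      2 + (suc n + 1)                      ≡⟨ cong (3 +_) (+-comm n 1) ⟩
      4 + n                                ≡⟨ +-comm 4 n ⟩
      n + 4                                ∎

  -- The tall job lies at some y ≥ 0 in the packing of any ordering, not only of those given by
  -- words.
  K≤height : (T : State inst) → ι K ℚ.≤ height inst (State.packing T)
  K≤height T = ℚ.≤-trans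
    (subst (ℚ._≤ proj₂ (packing i) ℚ.+ ι K) (ℚ.+-identityˡ (ι K)) (ℚ.+-monoˡ-≤ (ι K) 0≤y))
    (top≤height inst packing Fin.zero)
    where
    open State T
    i : Fin n
    i = Fin.zero
    0≤y : 0ℚ ℚ.≤ proj₂ (packing i)
    0≤y = subst (λ j → 0ℚ ℚ.≤ proj₂ (packing j)) (inverseʳ ordering)
      (proj₁ (proj₂ (proj₂ (proj₁ (isBottomLeft (ordering ⟨$⟩ˡ i))))))

  module _ (g : Word (suc m)) where
    private
      swap : ℕ → ℕ
      swap = swapPairs (bit g)

      swap-involutive : ∀ t → swap (swap t) ≡ t
      swap-involutive = swapPairs-involutive (bit g)

      swap₀ : swap 0 ≡ 0
      swap₀ = cong (if_then 1 else 0) (bit₀ g)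

    open Schedule (jobHeight K ∘ swap)

    place : Fin n → Fin n
    place t = fromℕ< (swapPairs-< (bit g) (suc (suc m)) (Fin.toℕ<n t))

    toℕ-place : ∀ t → toℕ (place t) ≡ swap (toℕ t)
    toℕ-place t = Fin.toℕ-fromℕ< _

    place-involutive : ∀ t → place (place t) ≡ t
    place-involutive t = Fin.toℕ-injective (begin
      toℕ (place (place t)) ≡⟨ toℕ-place (place t) ⟩
      swap (toℕ (place t))  ≡⟨ cong swap (toℕ-place t) ⟩
      swap (swap (toℕ t))   ≡⟨ swap-involutive (toℕ t) ⟩
      toℕ t                 ∎)
      where open ≡-Reasoning

    wordOrdering : Ordering inst
    wordOrdering = permutation place place place-involutive place-involutive

    -- The schedule is indexed by places and the packing by rectangles; `swap`, its own inverse,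
    -- translates both ways.
    wordPacking : Packing inst
    wordPacking i = corner (swap (toℕ i))

    swap-place : ∀ t → swap (toℕ (place t)) ≡ toℕ t
    swap-place t = trans (cong swap (toℕ-place t)) (swap-involutive (toℕ t))

    final-loads : Loads n (lo g) (hi g)
    final-loads = word-loads K (bit g) (bit₀ g) g (λ _ _ → refl)

    base<K : ∀ {u} → u < n → 0 < u → base u < jobHeight K (swap 0)
    base<K {suc u} u<n _ = subst (base (suc u) <_) (cong (jobHeight K) (sym swap₀))
      (≤-<-trans (base≤smaller n final-loads (<⇒≤ u<n)) (lo<bottom g))
    feasible⇒fits : ∀ t {h q} →
      0ℚ ℚ.≤ proj₁ q × proj₁ q ℚ.+ 1ℚ ℚ.≤ ι 3 × 0ℚ ℚ.≤ proj₂ q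
        × (∀ j → Before inst wordOrdering t j →
             UnitBox h q ⊥ Interior inst j (wordPacking j)) →
      FitsAt (toℕ t) h q
    feasible⇒fits t {h} {q} (0≤x , x≤W , 0≤y , free) = 0≤x , x≤W , 0≤y , λ u u<t →
      let u′  = fromℕ< (<-trans u<t (Fin.toℕ<n t))
          u′≡u = Fin.toℕ-fromℕ< (<-trans u<t (Fin.toℕ<n t))
      in subst₂ (λ a v → UnitBox h q ⊥ UnitBox (ι (jobHeight K a)) (corner v))
           (trans (toℕ-place u′) (cong swap u′≡u))
           (trans (swap-place u′) u′≡u)
           (free (place u′) (subst (_< toℕ t)
             (sym (trans (toℕ-place (place u′)) (trans (swap-place u′) u′≡u))) u<t))

    wordState : State inst
    wordState = record
      { ordering     = wordOrdering
      ; packing      = wordPacking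
      ; isBottomLeft = λ t → feasible t , least t
      }
      where
      feasible : ∀ t → Feasible inst (Before inst wordOrdering t) wordPacking
        (place t) (wordPacking (place t))
      feasible t rewrite swap-place t | toℕ-place t =
        let 0≤x , x≤W , 0≤y , free = corner-fits (toℕ t) in
        0≤x , x≤W , 0≤y , λ j j<t →
          subst (λ a → UnitBox (ι (jobHeight K (swap (toℕ t)))) (corner (toℕ t))
                  ⊥ UnitBox (ι (jobHeight K a)) (corner (swap (toℕ j))))
            (swap-involutive (toℕ j))
            (free (swap (toℕ j)) (subst (_< toℕ t) (toℕ-place j) j<t))
      least : ∀ t q → Feasible inst (Before inst wordOrdering t) wordPacking (place t) q →
        _≼_ inst (wordPacking (place t)) q
      least t q fits rewrite swap-place t =
        corner-least (toℕ t) (Instance.0<h inst (place t)) (base<K (Fin.toℕ<n t))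
          (feasible⇒fits t fits)

    height-upper : height inst wordPacking ℚ.≤ ι (hi g)
    height-upper = height-lub inst wordPacking (0≤ι (hi g)) top≤hi
      where
      load≤hi : ∀ u → load n (column u) ≤ hi g
      load≤hi zero    = subst (_≤ hi g)
        (sym (trans (load₀ (suc (suc m * 2))) (cong (jobHeight K) swap₀))) (bottom≤hi g)
      load≤hi (suc u) = load≤larger n final-loads (<⇒≤ (lo<hi g)) u
      top≤hi : ∀ i → ι (base (swap (toℕ i))) ℚ.+ ι (jobHeight K (toℕ i)) ℚ.≤ ι (hi g)
      top≤hi i = ℚ.≤-trans (ℚ.≤-reflexive (ι-+ u-base _)) (ι-mono-≤ (begin
        u-base + jobHeight K (toℕ i)  ≡⟨ cong (λ a → u-base + jobHeight K a) (swap-involutive (toℕ i)) ⟨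
        u-base + jobHeight K (swap u) ≤⟨ top≤load u<n ⟩
        load n (column u)             ≤⟨ load≤hi u ⟩
        hi g                          ∎))
        where
        open ≤-Reasoning
        u u-base : ℕ
        u = swap (toℕ i)
        u-base = base u
        u<n : u < n
        u<n = swapPairs-< (bit g) (suc (suc m)) (Fin.toℕ<n i)

    -- Were the height below a load, `covered` would give a job of that column whose top exceeds the
    -- height.
    load≤height : ∀ c → ι (load n c) ℚ.≤ height inst wordPacking
    load≤height c = ℚ.≮⇒≥ λ height<load →
      let u , u<n , _ , _ , height<top = covered n c 0≤height height<load
          t = fromℕ< u<n
          t≡u = Fin.toℕ-fromℕ< u<n
          top-bound = subst₂ (λ v a → ι (base v) ℚ.+ ι (jobHeight K a) ℚ.≤ height inst wordPacking)
            (trans (swap-place t) t≡u) (trans (toℕ-place t) (cong swap t≡u))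
            (top≤height inst wordPacking (place t))
      in ℚ.<-irrefl refl (ℚ.<-≤-trans height<top top-bound)
      where
      0≤height : 0ℚ ℚ.≤ height inst wordPacking
      0≤height = ℚ.≤-trans (0≤ι K) (K≤height wordState)

    height-lower : ι (hi g) ℚ.≤ height inst wordPacking
    height-lower = larger-load n (λ l → ι l ℚ.≤ height inst wordPacking) final-loads load≤height

  improves : ∀ {k} → 2 ≤ k → ∀ {g g′} → Down g g′ →
    Improvement inst k (wordState g) (wordState g′)
  improves 2≤k {g} {g′} d =
      ≤-trans (count-window (λ t → ¬? (place g t Fin.≟ place g′ t)) (λ t → t) (i * 2) 2 window) 2≤k
    , ℚ.≤-<-trans (height-upper g′)
        (ℚ.<-≤-trans (ι-mono-< (proj₁ (down-narrows d))) (height-lower g))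
    where
    i = proj₁ (down-flips-one-bit d)
    window : ∀ t → place g t ≢ place g′ t → i * 2 ≤ toℕ t × toℕ t < i * 2 + 2
    window t differ = near (swapPairs-local i (proj₂ (down-flips-one-bit d)) (toℕ t) λ eq →
      differ (Fin.toℕ-injective (trans (toℕ-place g t) (trans eq (sym (toℕ-place g′ t))))))
      where
      near : ∀ {a u} → u ≡ a ⊎ u ≡ suc a → a ≤ u × u < a + 2
      near {a} (inj₁ refl) = ≤-refl , m<m+n a z<s
      near {a} (inj₂ refl) = n≤1+n a , ≤-reflexive (+-comm 2 a)

  -- Its height is at most `K`, a lower bound for every packing; so no `k` allows an improvement.
  bottom-optimal : ∀ {k} → LocalOptimum inst k (wordState (bottom m))
  bottom-optimal (T , _ , better) = ℚ.<-irrefl refl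
    (ℚ.<-≤-trans better (ℚ.≤-trans (height-upper (bottom m)) (K≤height T)))

theorem6 : (k : ℕ) → 2 ≤ k →
    ∃[ c ] ∃[ d ] ((N : ℕ) →
    Σ[ I ∈ Instance ] (N ≤ Instance.n I
    × encodingLength I ≤ d * Instance.n I ^ d
    × Σ[ S ∈ State I ] Σ[ T ∈ State I ] Σ[ r ∈ Run I k S T ]
    (LocalOptimum I k T × 2 ^ Instance.n I ≤ steps I r ^ c)))
-- The walk has at least 2^(N+1) steps, and n = 2(N+3) ≤ 6(N+1) gives the exponent 6;
-- `encodingLength-poly` gives 8. Parameter `suc N` keeps the exponent N+1 positive.
theorem6 k 2≤k = 6 , 8 , λ N →
  let open Construction (suc N)
      r , r-long = gray-down (suc N)
  in inst , N≤n N , encodingLength-poly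
     , wordState (top (2 + N)) , wordState (bottom (suc N))
     , gmap wordState (improves 2≤k) r
     , bottom-optimal
     , ≤-trans (exponent N) (^-monoˡ-≤ 6 (≤-trans r-long
         (≤-reflexive (sym (length-gmap wordState (improves 2≤k) r)))))
  where
  N≤n : ∀ N → N ≤ (3 + N) * 2
  N≤n N = ≤-trans (m≤n+m N 3) (m≤m*n (3 + N) 2)
  exponent : ∀ N → 2 ^ ((3 + N) * 2) ≤ (2 ^ suc N) ^ 6
  exponent N = begin
    2 ^ ((3 + N) * 2)           ≤⟨ ^-monoʳ-≤ 2 (+-monoˡ-≤ (suc N * 2) (m≤n*m 4 (suc N))) ⟩
    2 ^ (suc N * 4 + suc N * 2) ≡⟨ cong (2 ^_) (*-distribˡ-+ (suc N) 4 2) ⟨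
    2 ^ (suc N * 6)             ≡⟨ ^-*-assoc 2 (suc N) 6 ⟨
    (2 ^ suc N) ^ 6             ∎
    where open ≤-Reasoning
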